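{- Let $G$ be a daisy cube. Then the Wiener index $W(G)$ and the Mostar index $\mathit{Mo}(G)$ of $G$ satisfy $$2W(G)-\mathit{Mo}(G)=|V(G)|\,|E(G)|.$$
   Context: Let $B=\{0,1\}$; elements of $B^n$ are written as binary strings $u=u_1\ldots u_n$. The hypercube $Q_n$ has vertex set $B^n$, two vertices being adjacent iff they differ in precisely one coordinate. The distance $d(u,v)$ between two vertices of a connected graph is the number of edges on a shortest $u,v$-path. A subgraph $G$ of a graph $H$ is isometric if the distance in $G$ between any two vertices of $G$ equals their distance in $H$. Let $\le$ be the partial order on $B^n$ with $u\le v$ iff $u_i\le v_i$ for all $i\in\{1,\ldots,n\}$. For $X\subseteq B^n$, the daisy cube generated by $X$ is $Q_n(X)$, the subgraph of $Q_n$ induced by $\{u\in B^n : u\le x \text{ for some } x\in X\}$. A graph $G$ is a daisy cube if there exist an isometric embedding of $G$ in some hypercube $Q_n$ and a subset $X\subseteq B^n$ such that (the image of) $G$ is the daisy cube $Q_n(X)$ generated by $X$. The Wiener index of a connected graph $G$ is $W(G)=\sum_{\{u,v\}\subset V(G)}d(u,v)$, the sum being over unordered pairs of vertices. For an edge $uv\in E(G)$, $n_{u,v}$ denotes the number of vertices of $G$ that are (strictly) closer to $u$ than to $v$. The Mostar index is $\mathit{Mo}(G)=\sum_{uv\in E(G)}|n_{u,v}-n_{v,u}|$, the sum being over the edges of $G$. -}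

module Defs where

open import Data.Bool.Base using (Bool; true; false; _≤_)
import Data.Bool.Properties as Bool
open import Data.Fin.Base using (Fin; zero; suc)
import Data.Fin.Properties as Fin
open import Data.List.Base as List using (List; []; _∷_; _++_; length; filter)
open import Data.Nat.Base as ℕ using (ℕ; zero; suc; z≤n; s≤s; ∣_-_∣)
import Data.Nat.Properties as ℕ
open import Data.Nat.ListAction using (sum)
open import Data.Product using (∃; ∃!; ∃₂; _×_; _,_; proj₁; proj₂; uncurry)
open import Data.Vec.Base as Vec using (Vec; []; _∷_; head; last; lookup; initLast)
import Data.Vec.Properties as Vec
open import Data.Vec.Relation.Binary.Pointwise.Inductive using (Pointwise)
open import Data.Vec.Relation.Unary.All as All using (All; []; _∷_)
import Data.Vec.Relation.Unary.All.Properties as All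
open import Data.Vec.Relation.Unary.AllPairs using ([]; _∷_; allPairs?)
open import Data.Vec.Relation.Unary.Linked as Linked using (Linked; [-]; _∷_; linked?)
import Data.Vec.Relation.Unary.Linked.Properties as Linked
open import Data.Vec.Relation.Unary.Unique.Propositional using (Unique)
import Data.Vec.Relation.Unary.Unique.Propositional.Properties as Unique
open import Function.Base using (_∘_)
open import Function.Bundles using (_⇔_; _↔_; Equivalence; Inverse)
open import Function.Definitions using (Injective)
open import Function.Properties.Inverse using (↔⇒↣; ↔-sym)
open import Level using (0ℓ)
open import Relation.Binary.Core as Binary using (Rel)
open import Relation.Binary.Definitions as Binary
  using (Symmetric; Irreflexive; DecidableEquality)
open import Relation.Binary.PropositionalEquality
  using (_≡_; _≢_; refl; sym; trans; cong; subst)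
open import Relation.Nullary using (Dec; yes; no; contradiction)
open import Relation.Nullary.Decidable
  using (map′; _×-dec_; _→-dec_; ¬?; via-injection)
open import Relation.Unary as Unary using (Pred)

------------------------------------------------------------------------
-- Simple graphs, paths and distance

record Graph : Set₁ where
  infix 4 _~_
  field
    Vertex   : Set
    _~_      : Rel Vertex 0ℓ
    ~-sym    : Symmetric _~_
    ~-irrefl : Irreflexive _≡_ _~_

module _ (G : Graph) where
  open Graph G

  -- A path with k edges is given by its k + 1 pairwise distinct vertices.
  record IsPath (u v : Vertex) {k : ℕ} (xs : Vec Vertex (suc k)) : Set where
    constructor isPath
    field
      starts : head xs ≡ u
      ends   : last xs ≡ v
      linked : Linked _~_ xs
      unique : Unique xs

  HasPath : Vertex → Vertex → Pred ℕ 0ℓ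
  HasPath u v k = ∃ λ (xs : Vec Vertex (suc k)) → IsPath u v xs

  Connected : Set
  Connected = ∀ u v → ∃ (HasPath u v)

  -- d(u,v) = k, as a relation: it makes sense whether or not G is finite
  -- or connected.
  IsDistance : Vertex → Vertex → Pred ℕ 0ℓ
  IsDistance u v k = HasPath u v k × (∀ l → HasPath u v l → k ℕ.≤ l)

-- Decidable adjacency is not a restriction on finite graphs classically;
-- it is what makes edges countable here.
record FiniteGraph : Set₁ where
  field
    graph : Graph
  open Graph graph public
  field
    order : ℕ
    enum  : Fin order ↔ Vertex
    _~?_  : Binary.Decidable _~_

------------------------------------------------------------------------
-- Isometric embeddings and daisy cubes

record Subgraph (H : Graph) : Set₁ where
  open Graph H
  field
    IsVertex      : Pred Vertex 0ℓ
    IsEdge        : Rel Vertex 0ℓ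
    edge-sym      : Symmetric IsEdge
    edge-adjacent : ∀ {u v} → IsEdge u v → u ~ v
    edge-vertex   : ∀ {u v} → IsEdge u v → IsVertex u

infix 4 _≐_
_≐_ : {H : Graph} → Subgraph H → Subgraph H → Set
S ≐ T = (Subgraph.IsVertex S Unary.≐ Subgraph.IsVertex T)
      × (Subgraph.IsEdge S Binary.⇔ Subgraph.IsEdge T)

induced : (H : Graph) → Pred (Graph.Vertex H) 0ℓ → Subgraph H
induced H P = record
  { IsVertex      = P
  ; IsEdge        = λ u v → P u × P v × u ~ v
  ; edge-sym      = λ (pu , pv , u~v) → pv , pu , ~-sym u~v
  ; edge-adjacent = λ (_ , _ , u~v) → u~v
  ; edge-vertex   = λ (pu , _ , _) → pu
  }
  where open Graph H

record IsometricEmbedding (G H : Graph) : Set where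
  private
    module G = Graph G
    module H = Graph H
  field
    to        : G.Vertex → H.Vertex
    injective : Injective _≡_ _≡_ to
    adjacent  : ∀ {u v} → u G.~ v → to u H.~ to v
    isometric : ∀ u v k → IsDistance G u v k ⇔ IsDistance H (to u) (to v) k

image : {G H : Graph} → IsometricEmbedding G H → Subgraph H
image {G} {H} f = record
  { IsVertex      = λ x → ∃ λ u → to u ≡ x
  ; IsEdge        = λ x y → ∃₂ λ u v → u G.~ v × to u ≡ x × to v ≡ y
  ; edge-sym      = λ (u , v , u~v , p , q) → v , u , G.~-sym u~v , q , p
  ; edge-adjacent = λ { (_ , _ , u~v , refl , refl) → adjacent u~v }
  ; edge-vertex   = λ (u , _ , _ , p , _) → u , p
  }
  where
  open IsometricEmbedding f
  module G = Graph G

DiffersAt : ∀ {n} → Vec Bool n → Vec Bool n → Pred (Fin n) 0ℓ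
DiffersAt u v i = lookup u i ≢ lookup v i

Q : ℕ → Graph
Q n = record
  { Vertex   = Vec Bool n
  ; _~_      = λ u v → ∃! _≡_ (DiffersAt u v)
  ; ~-sym    = λ (i , ne , uniq) → i , ne ∘ sym , λ ne′ → uniq (ne′ ∘ sym)
  ; ~-irrefl = λ { refl (_ , ne , _) → ne refl }
  }

Q⟨_⟩ : ∀ {n} → Pred (Vec Bool n) 0ℓ → Subgraph (Q n)
Q⟨_⟩ {n} X = induced (Q n) λ u → ∃ λ x → X x × Pointwise _≤_ u x

IsDaisyCube : Graph → Set₁
IsDaisyCube G = ∃ λ n → ∃ λ (f : IsometricEmbedding G (Q n)) →
                ∃ λ (X : Pred (Vec Bool n) 0ℓ) → image f ≐ Q⟨ X ⟩

------------------------------------------------------------------------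
-- The distance function of a finite connected graph

least : {P : Pred ℕ 0ℓ} → Unary.Decidable P → ∀ k → P k →
        ∃ λ m → P m × (∀ l → P l → m ℕ.≤ l)
least P? k pk with P? 0
... | yes p0 = 0 , p0 , λ _ _ → z≤n
least P? zero    pk | no ¬p0 = contradiction pk ¬p0
least P? (suc k) pk | no ¬p0 with least (P? ∘ suc) k pk
... | m , pm , min = suc m , pm , λ where
  zero    p0 → contradiction p0 ¬p0
  (suc l) pl → s≤s (min l pl)

Searchable : Set → Set₁
Searchable A = {P : Pred A 0ℓ} → Unary.Decidable P → Dec (∃ P)

search-Vec : {A : Set} → Searchable A → ∀ n → Searchable (Vec A n)
search-Vec search zero    P? = map′ ([] ,_) (λ { ([] , p) → p }) (P? [])
search-Vec search (suc n) P? =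
  map′ (λ (x , xs , p) → x ∷ xs , p) (λ { (x ∷ xs , p) → x , xs , p })
       (search λ x → search-Vec search n (P? ∘ (x ∷_)))

module _ (G : Graph) (search : Searchable (Graph.Vertex G))
         (_≟_ : DecidableEquality (Graph.Vertex G))
         (_~?_ : Binary.Decidable (Graph._~_ G)) where
  open Graph G

  hasPath? : ∀ u v → Unary.Decidable (HasPath G u v)
  hasPath? u v k = search-Vec search (suc k) λ xs →
    map′ (λ (a , b , c , d) → isPath a b c d) (λ (isPath a b c d) → a , b , c , d)
      ((head xs ≟ u) ×-dec (last xs ≟ v) ×-dec linked? _~?_ xs
       ×-dec allPairs? (λ x y → ¬? (x ≟ y)) xs)

  shortest : ∀ {u v} → ∃ (HasPath G u v) → ∃ (IsDistance G u v)
  shortest {u} {v} (k , p) = least (hasPath? u v) k p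

module _ (G : FiniteGraph) where
  open FiniteGraph G
  open Inverse enum using (strictlyInverseˡ)

  search-Vertex : Searchable Vertex
  search-Vertex {P} P? = map′
    (λ (i , p) → Inverse.to enum i , p)
    (λ (v , p) → Inverse.from enum v , subst P (sym (strictlyInverseˡ v)) p)
    (Fin.any? (P? ∘ Inverse.to enum))

  _≟ᵛ_ : DecidableEquality Vertex
  _≟ᵛ_ = via-injection (↔⇒↣ (↔-sym enum)) Fin._≟_

  module _ (conn : Connected graph) where

    shortestPath : ∀ u v → ∃ (IsDistance graph u v)
    shortestPath u v = shortest graph search-Vertex _≟ᵛ_ _~?_ (conn u v)

    d : Vertex → Vertex → ℕ
    d u v = proj₁ (shortestPath u v)

    d-isDistance : ∀ u v → IsDistance graph u v (d u v)
    d-isDistance u v = proj₂ (shortestPath u v)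

------------------------------------------------------------------------
-- Wiener and Mostar indices

-- Each 2-element subset of positions of the list, once.
unorderedPairs : {A : Set} → List A → List (A × A)
unorderedPairs []       = []
unorderedPairs (x ∷ xs) = List.map (x ,_) xs ++ unorderedPairs xs

module _ (G : FiniteGraph) where
  open FiniteGraph G

  vertices : List Vertex
  vertices = List.tabulate (Inverse.to enum)

  edges : List (Vertex × Vertex)
  edges = filter (λ (u , v) → u ~? v) (unorderedPairs vertices)

  size : ℕ
  size = length edges

  module _ (conn : Connected graph) where

    wiener : ℕ
    wiener = sum (List.map (uncurry (d G conn)) (unorderedPairs vertices))

    closer : Vertex → Vertex → ℕ
    closer u v = length (filter (λ w → d G conn w u ℕ.<? d G conn w v) vertices)

    mostar : ℕ
    mostar = sum (List.map (λ (u , v) → ∣ closer u v - closer v u ∣) edges)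

------------------------------------------------------------------------
-- Daisy cubes are connected, so the indices above are defined for them

last-∷ : {A : Set} {n : ℕ} (x : A) (xs : Vec A (suc n)) → last (x ∷ xs) ≡ last xs
last-∷ x xs with initLast xs
... | _ , _ , refl = refl

last-map : {A B : Set} (f : A → B) {n : ℕ} (xs : Vec A (suc n)) →
           last (Vec.map f xs) ≡ f (last xs)
last-map f (x ∷ [])     = refl
last-map f (x ∷ y ∷ xs) = trans (last-∷ (f x) (Vec.map f (y ∷ xs)))
  (trans (last-map f (y ∷ xs)) (cong f (sym (last-∷ x (y ∷ xs)))))

head-map : {A B : Set} (f : A → B) {n : ℕ} (xs : Vec A (suc n)) →
           head (Vec.map f xs) ≡ f (head xs)
head-map f (x ∷ xs) = refl

∷-adjacent : ∀ {n} (b : Bool) {u v : Vec Bool n} →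
             Graph._~_ (Q n) u v → Graph._~_ (Q (suc n)) (b ∷ u) (b ∷ v)
∷-adjacent b {u} {v} (i , ne , uniq) = suc i , ne , λ {j} → uniq′ j
  where
  uniq′ : ∀ j → DiffersAt (b ∷ u) (b ∷ v) j → suc i ≡ j
  uniq′ zero    ne′ = contradiction refl ne′
  uniq′ (suc j) ne′ = cong suc (uniq ne′)

flip-adjacent : ∀ {n} {a b : Bool} (u : Vec Bool n) → a ≢ b →
                Graph._~_ (Q (suc n)) (a ∷ u) (b ∷ u)
flip-adjacent {a = a} {b} u a≢b = zero , a≢b , λ {j} → uniq j
  where
  uniq : ∀ j → DiffersAt (a ∷ u) (b ∷ u) j → zero ≡ j
  uniq zero    _  = refl
  uniq (suc j) ne = contradiction refl ne

Q-connected : ∀ n → Connected (Q n)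
Q-connected zero    []      []      = 0 , [] ∷ [] , isPath refl refl [-] ([] ∷ [])
Q-connected (suc n) (a ∷ u) (b ∷ v) with Q-connected n u v
... | k , xs , isPath refl refl linked unique = extend (a Bool.≟ b)
  where
  ys : Vec (Vec Bool (suc n)) (suc k)
  ys = Vec.map (b ∷_) xs

  ys-linked : Linked (Graph._~_ (Q (suc n))) ys
  ys-linked = Linked.map⁺ (Linked.map (∷-adjacent b) linked)

  ys-unique : Unique ys
  ys-unique = Unique.map⁺ Vec.∷-injectiveʳ unique

  extend : Dec (a ≡ b) → ∃ (HasPath (Q (suc n)) (a ∷ head xs) (b ∷ last xs))
  extend (yes refl) =
    k , ys , isPath (head-map (b ∷_) xs) (last-map (b ∷_) xs) ys-linked ys-unique
  extend (no a≢b) = suc k , (a ∷ head xs) ∷ ys , isPath refl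
    (trans (last-∷ (a ∷ head xs) ys) (last-map (b ∷_) xs))
    (subst (Graph._~_ (Q (suc n)) (a ∷ head xs)) (sym (head-map (b ∷_) xs))
           (flip-adjacent (head xs) a≢b) ∷ ys-linked)
    (All.map⁺ (All.universal (λ _ eq → a≢b (Vec.∷-injectiveˡ eq)) xs) ∷ ys-unique)

search-Bool : Searchable Bool
search-Bool P? with P? true | P? false
... | yes p | _     = yes (true , p)
... | no _  | yes p = yes (false , p)
... | no ¬p | no ¬q = no λ { (true , p) → ¬p p ; (false , q) → ¬q q }

Q-adjacent? : ∀ n → Binary.Decidable (Graph._~_ (Q n))
Q-adjacent? n u v = map′
  (λ (i , ne , uniq) → i , ne , λ {j} → uniq j)
  (λ (i , ne , uniq) → i , ne , λ j → uniq {j})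
  (Fin.any? λ i → differs? i ×-dec Fin.all? λ j → differs? j →-dec (i Fin.≟ j))
  where
  differs? : Unary.Decidable (DiffersAt u v)
  differs? i = ¬? (lookup u i Bool.≟ lookup v i)

daisyCube⇒connected : {G : Graph} → IsDaisyCube G → Connected G
daisyCube⇒connected (n , f , _) u v =
  let k , dist = shortest (Q n) (search-Vec search-Bool n) (Vec.≡-dec Bool._≟_)
                   (Q-adjacent? n) (Q-connected n (to u) (to v))
  in k , proj₁ (Equivalence.from (isometric u v k) dist)
  where open IsometricEmbedding f

{-# OPTIONS --safe #-}
module Submission where

-- Embed G in the hypercube and, for a coordinate i, let aᵢ and bᵢ be the numbers
-- of vertices with i-th bit 1 and 0. Distances are Hamming distances, so
-- W = Σ aᵢ bᵢ. Switching off bit i never leaves a daisy cube, so aᵢ ≤ bᵢ and there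
-- are exactly aᵢ edges in direction i; each of them contributes bᵢ − aᵢ to Mo,
-- because the vertices closer to an end are those sharing its i-th bit. Hence
-- Mo + |V| |E| = Σ aᵢ ((bᵢ − aᵢ) + (aᵢ + bᵢ)) = 2 W.

open import Defs
open import Data.Bool.Base using (Bool; true; false)
import Data.Bool.Base as Bool
import Data.Bool.Properties as Bool
open import Data.Fin.Base using (Fin; zero; suc)
import Data.Fin.Properties as Fin
import Data.Integer.Properties as ℤ
open import Data.List.Base as List using (List; []; _∷_; _++_; filter; length; tabulate)
import Data.List.Properties as List
open import Data.Nat.Base using (ℕ; zero; suc; _+_; _*_; _≤_; _<_; z≤n; s≤s; ∣_-_∣; _∸_)
import Data.Nat.ListAction as Listᴺ
open import Data.Nat.ListAction.Properties using (sum-++)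
open import Data.Nat.Properties as ℕ
  using (+-identityʳ; +-comm; *-identityˡ; ≤-reflexive; ≤-trans; ≤-antisym; +-mono-≤)
open import Data.Nat.Tactic.RingSolver using (solve-∀)
open import Data.Product using (∃; _×_; _,_; proj₁; proj₂; uncurry)
open import Data.Vec.Base as Vec using (Vec; []; _∷_; head; last; lookup; _[_]≔_)
import Data.Vec.Properties as Vec
open import Data.Vec.Relation.Binary.Pointwise.Extensional
  using (ext; extensional⇒inductive; Pointwise-≡⇒≡)
import Data.Vec.Relation.Binary.Pointwise.Inductive as Pointwise
open import Data.Vec.Relation.Unary.Linked using (Linked; [-]; _∷_)
open import Function.Base using (_∘_; _$_)
open import Function.Bundles using (_⇔_; mk⇔; Equivalence; Injection; Inverse)
open import Function.Properties.Inverse using (↔⇒↣)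
open import Function.Definitions using (Injective)
open import Level using (0ℓ)
open import Relation.Binary.PropositionalEquality
  using (_≡_; _≢_; refl; sym; trans; cong; cong₂; subst; subst₂; module ≡-Reasoning)
open import Relation.Nullary using (Dec; yes; no; ¬_; contradiction)
open import Relation.Nullary.Decidable using (_×-dec_; decidable-stable)
open import Relation.Unary as Unary using (Pred)
open import Algebra.Properties.Semiring.Sum ℕ.+-*-semiring

-- Indicators and finite sums

𝟙 : {A : Set} → Dec A → ℕ
𝟙 (yes _) = 1
𝟙 (no _)  = 0

𝟙-true : {A : Set} (a? : Dec A) → A → 𝟙 a? ≡ 1
𝟙-true (yes _) _ = refl
𝟙-true (no ¬a) a = contradiction a ¬a

𝟙-false : {A : Set} (a? : Dec A) → ¬ A → 𝟙 a? ≡ 0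
𝟙-false (yes a) ¬a = contradiction a ¬a
𝟙-false (no _)  _  = refl

𝟙-cong : {A B : Set} (a? : Dec A) (b? : Dec B) → A ⇔ B → 𝟙 a? ≡ 𝟙 b?
𝟙-cong a? (yes b) A⇔B = 𝟙-true a? (Equivalence.from A⇔B b)
𝟙-cong a? (no ¬b) A⇔B = 𝟙-false a? (¬b ∘ Equivalence.to A⇔B)

𝟙≤1 : {A : Set} (a? : Dec A) → 𝟙 a? ≤ 1
𝟙≤1 (yes _) = s≤s z≤n
𝟙≤1 (no _)  = z≤n

sum-zero : ∀ {n} {f : Fin n → ℕ} → (∀ i → f i ≡ 0) → sum f ≡ 0
sum-zero {n} f≡0 = trans (sum-cong-≗ f≡0) (sum-replicate-zero n)

sum-const-1 : ∀ n → ∑[ _ < n ] 1 ≡ n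
sum-const-1 zero    = refl
sum-const-1 (suc n) = cong suc (sum-const-1 n)

sum-mono-≤ : ∀ {n} {f g : Fin n → ℕ} → (∀ i → f i ≤ g i) → sum f ≤ sum g
sum-mono-≤ {zero}  f≤g = z≤n
sum-mono-≤ {suc n} f≤g = +-mono-≤ (f≤g zero) (sum-mono-≤ (f≤g ∘ suc))

-- The two sums differ only by their terms at `i`; adding the terms crosswise avoids subtraction in
-- `ℕ`.
sum-cong-except : ∀ {n} (f g : Fin n → ℕ) i → (∀ j → i ≢ j → f j ≡ g j) →
                  sum f + g i ≡ sum g + f i
sum-cong-except f g zero f≡g
  rewrite sum-cong-≗ {x = f ∘ suc} {g ∘ suc} (λ j → f≡g (suc j) λ ()) =
  swap (f zero) (sum (g ∘ suc)) (g zero)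
  where
  swap : ∀ a b c → a + b + c ≡ c + b + a
  swap = solve-∀
sum-cong-except f g (suc i) f≡g = begin
  f zero + sum (f ∘ suc) + g (suc i)    ≡⟨ ℕ.+-assoc (f zero) _ _ ⟩
  f zero + (sum (f ∘ suc) + g (suc i))  ≡⟨ cong₂ _+_ (f≡g zero λ ())
                                             (sum-cong-except (f ∘ suc) (g ∘ suc) i
                                               λ j i≢j → f≡g (suc j) (i≢j ∘ Fin.suc-injective)) ⟩
  g zero + (sum (g ∘ suc) + f (suc i))  ≡⟨ ℕ.+-assoc (g zero) _ _ ⟨
  g zero + sum (g ∘ suc) + f (suc i)    ∎
  where open ≡-Reasoning

sum-single : ∀ {n} (f : Fin n → ℕ) i → (∀ j → i ≢ j → f j ≡ 0) → sum f ≡ f i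
sum-single {n} f i f≡0 = begin
  sum f                       ≡⟨ +-identityʳ _ ⟨
  sum f + 0                   ≡⟨ sum-cong-except f (λ _ → 0) i f≡0 ⟩
  sum {n} (λ _ → 0) + f i     ≡⟨ cong (_+ f i) (sum-zero {n} λ _ → refl) ⟩
  f i                         ∎
  where open ≡-Reasoning

sum-𝟙≤1 : ∀ {n} {P : Pred (Fin n) 0ℓ} (P? : Unary.Decidable P) →
          (∀ {i j} → P i → P j → i ≡ j) → ∑[ i < n ] 𝟙 (P? i) ≤ 1
sum-𝟙≤1 P? unique with Fin.any? P?
... | no ¬∃P = subst (_≤ 1) (sym (sum-zero λ i → 𝟙-false (P? i) λ p → ¬∃P (i , p))) z≤n
... | yes (i , p) = subst (_≤ 1)
  (sym (sum-single (𝟙 ∘ P?) i λ j i≢j → 𝟙-false (P? j) (i≢j ∘ unique p)))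
  (𝟙≤1 (P? i))

-- Brings the sum over directions outside the sums over pairs of vertices, so that each direction
-- can be counted on its own.
∑-rotate : ∀ {l m n} (f : Fin l → Fin m → Fin n → ℕ) →
           ∑[ j < m ] ∑[ k < n ] ∑[ i < l ] f i j k ≡
           ∑[ i < l ] ∑[ j < m ] ∑[ k < n ] f i j k
∑-rotate f = trans (sum-cong-≗ λ j → ∑-comm λ k i → f i j k)
                   (∑-comm λ j i → sum (f i j))

∑-distrib-*₂ : ∀ {m n} (f : Fin m → ℕ) (g : Fin n → ℕ) →
               ∑[ j < m ] ∑[ k < n ] (f j * g k) ≡ sum f * sum g
∑-distrib-*₂ f g = trans (sum-cong-≗ λ j → sym (*-distribˡ-sum (f j) g))
                         (sym (*-distribʳ-sum (sum g) f))

∑∑-*-distribʳ : ∀ {m n} (f : Fin m → Fin n → ℕ) c →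
                ∑[ j < m ] ∑[ k < n ] (f j k * c) ≡ (∑[ j < m ] ∑[ k < n ] f j k) * c
∑∑-*-distribʳ f c = trans (sum-cong-≗ λ j → sym (*-distribʳ-sum c (f j)))
                          (sym (*-distribʳ-sum c (sum ∘ f)))

-- From sums over lists to indexed sums

sum-tabulate : ∀ {n} (f : Fin n → ℕ) → Listᴺ.sum (tabulate f) ≡ sum f
sum-tabulate {zero}  f = refl
sum-tabulate {suc n} f = cong (f zero +_) (sum-tabulate (f ∘ suc))

length≡sum : {A : Set} (xs : List A) → length xs ≡ Listᴺ.sum (List.map (λ _ → 1) xs)
length≡sum []       = refl
length≡sum (x ∷ xs) = cong suc (length≡sum xs)

sum-map-filter : {A : Set} {P : Pred A 0ℓ} (P? : Unary.Decidable P) (f : A → ℕ) →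
                 ∀ xs → Listᴺ.sum (List.map f (filter P? xs)) ≡
                        Listᴺ.sum (List.map (λ x → 𝟙 (P? x) * f x) xs)
sum-map-filter P? f []       = refl
sum-map-filter P? f (x ∷ xs) with P? x
... | yes _ = cong₂ _+_ (sym (*-identityˡ (f x))) (sum-map-filter P? f xs)
... | no  _ = sum-map-filter P? f xs

length-filter-tabulate : {A : Set} {P : Pred A 0ℓ} (P? : Unary.Decidable P) →
                         ∀ {n} (g : Fin n → A) →
                         length (filter P? (tabulate g)) ≡ ∑[ k < n ] 𝟙 (P? (g k))
length-filter-tabulate P? {n} g = begin
  length (filter P? (tabulate g))                                ≡⟨ length≡sum (filter P? (tabulate g)) ⟩
  Listᴺ.sum (List.map (λ _ → 1) (filter P? (tabulate g)))        ≡⟨ sum-map-filter P? (λ _ → 1) (tabulate g) ⟩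
  Listᴺ.sum (List.map (λ x → 𝟙 (P? x) * 1) (tabulate g))         ≡⟨ cong Listᴺ.sum (List.map-tabulate g _) ⟩
  Listᴺ.sum (tabulate λ k → 𝟙 (P? (g k)) * 1)                    ≡⟨ sum-tabulate (λ k → 𝟙 (P? (g k)) * 1) ⟩
  ∑[ k < n ] (𝟙 (P? (g k)) * 1)                                  ≡⟨ sum-cong-≗ (λ k → ℕ.*-identityʳ (𝟙 (P? (g k)))) ⟩
  ∑[ k < n ] 𝟙 (P? (g k))                                        ∎
  where open ≡-Reasoning

-- A sum over unordered pairs is a sum over ordered pairs once the summand is
-- split into the contributions of the two orientations.
sum-unorderedPairs :
  {A : Set} (f : A × A → ℕ) → ∀ {n} (g : Fin n → A) (h : Fin n → Fin n → ℕ) →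
  (∀ j k → f (g j , g k) ≡ h j k + h k j) → (∀ j → h j j ≡ 0) →
  Listᴺ.sum (List.map f (unorderedPairs (tabulate g))) ≡ ∑[ j < n ] ∑[ k < n ] h j k
sum-unorderedPairs f {zero}  g h f≡h h≡0 = refl
sum-unorderedPairs f {suc n} g h f≡h h≡0 = begin
  Listᴺ.sum (List.map f (row ++ rest))
    ≡⟨ cong Listᴺ.sum (List.map-++ f row rest) ⟩
  Listᴺ.sum (List.map f row ++ List.map f rest)
    ≡⟨ sum-++ (List.map f row) (List.map f rest) ⟩
  Listᴺ.sum (List.map f row) + Listᴺ.sum (List.map f rest)
    ≡⟨ cong₂ _+_ sum-row
         (sum-unorderedPairs f (g ∘ suc) (λ j k → h (suc j) (suc k))
            (λ j k → f≡h (suc j) (suc k)) (h≡0 ∘ suc)) ⟩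
  ∑[ k < n ] h zero (suc k) + ∑[ k < n ] h (suc k) zero
    + ∑[ j < n ] ∑[ k < n ] h (suc j) (suc k)
    ≡⟨ ℕ.+-assoc (∑[ k < n ] h zero (suc k)) _ _ ⟩
  ∑[ k < n ] h zero (suc k)
    + (∑[ k < n ] h (suc k) zero + ∑[ j < n ] ∑[ k < n ] h (suc j) (suc k))
    ≡⟨ cong₂ _+_ (cong (_+ ∑[ k < n ] h zero (suc k)) (h≡0 zero))
         (∑-distrib-+ (λ j → h (suc j) zero) (λ j → ∑[ k < n ] h (suc j) (suc k))) ⟨
  h zero zero + ∑[ k < n ] h zero (suc k)
    + ∑[ j < n ] (h (suc j) zero + ∑[ k < n ] h (suc j) (suc k))
    ∎
  where
  open ≡-Reasoning
  row  = List.map (g zero ,_) (tabulate (g ∘ suc))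
  rest = unorderedPairs (tabulate (g ∘ suc))

  sum-row : Listᴺ.sum (List.map f row) ≡
            ∑[ k < n ] h zero (suc k) + ∑[ k < n ] h (suc k) zero
  sum-row = begin
    Listᴺ.sum (List.map f row)
      ≡⟨ cong (Listᴺ.sum ∘ List.map f) (List.map-tabulate (g ∘ suc) (g zero ,_)) ⟩
    Listᴺ.sum (List.map f (tabulate λ k → g zero , g (suc k)))
      ≡⟨ cong Listᴺ.sum (List.map-tabulate (λ k → g zero , g (suc k)) f) ⟩
    Listᴺ.sum (tabulate λ k → f (g zero , g (suc k)))
      ≡⟨ sum-tabulate (λ k → f (g zero , g (suc k))) ⟩
    ∑[ k < n ] f (g zero , g (suc k))
      ≡⟨ sum-cong-≗ (λ k → f≡h zero (suc k)) ⟩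
    ∑[ k < n ] (h zero (suc k) + h (suc k) zero)
      ≡⟨ ∑-distrib-+ (λ k → h zero (suc k)) (λ k → h (suc k) zero) ⟩
    ∑[ k < n ] h zero (suc k) + ∑[ k < n ] h (suc k) zero
      ∎

-- Bits and the Hamming distance

-- A product of indicators in separate variables, so that its sum over ordered pairs of vertices
-- factors into a product of two counts.
rise : Bool → Bool → ℕ
rise a b = 𝟙 (a Bool.≟ false) * 𝟙 (b Bool.≟ true)

rise-refl : ∀ a → rise a a ≡ 0
rise-refl false = refl
rise-refl true  = refl

-- The indicator of `a ≢ b`, split into two orientations as `sum-unorderedPairs` requires.
diff : Bool → Bool → ℕ
diff a b = rise a b + rise b a

diff-refl : ∀ a → diff a a ≡ 0
diff-refl false = refl
diff-refl true  = refl

diff-≢ : ∀ {a b} → a ≢ b → diff a b ≡ 1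
diff-≢ {false} {false} a≢b = contradiction refl a≢b
diff-≢ {false} {true}  a≢b = refl
diff-≢ {true}  {false} a≢b = refl
diff-≢ {true}  {true}  a≢b = contradiction refl a≢b

diff-triangle : ∀ a b c → diff a c ≤ diff a b + diff b c
diff-triangle false false c     = ℕ.≤-refl
diff-triangle true  true  c     = ℕ.≤-refl
diff-triangle false true  false = z≤n
diff-triangle false true  true  = ℕ.≤-refl
diff-triangle true  false false = ℕ.≤-refl
diff-triangle true  false true  = z≤n

≢-≢⇒≡ : ∀ {a b c : Bool} → a ≢ b → c ≢ b → a ≡ c
≢-≢⇒≡ a≢b c≢b = trans (Bool.¬-not a≢b) (sym (Bool.¬-not c≢b))

hamming : ∀ {n} → Vec Bool n → Vec Bool n → ℕ
hamming {n} x y = ∑[ i < n ] diff (lookup x i) (lookup y i)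

hamming-refl : ∀ {n} (x : Vec Bool n) → hamming x x ≡ 0
hamming-refl x = sum-zero λ i → diff-refl (lookup x i)

hamming-triangle : ∀ {n} (x y z : Vec Bool n) → hamming x z ≤ hamming x y + hamming y z
hamming-triangle x y z = ≤-trans
  (sum-mono-≤ λ i → diff-triangle (lookup x i) (lookup y i) (lookup z i))
  (≤-reflexive (∑-distrib-+ (λ i → diff (lookup x i) (lookup y i)) _))

module _ {n : ℕ} where
  open Graph (Q n)

  ~⇒agree : ∀ {x y : Vec Bool n} ((i , _) : x ~ y) j → i ≢ j → lookup x j ≡ lookup y j
  ~⇒agree {x} {y} (_ , _ , unique) j i≢j =
    decidable-stable (lookup x j Bool.≟ lookup y j) (i≢j ∘ unique)

  hamming-~ : ∀ {x y : Vec Bool n} → x ~ y → hamming x y ≡ 1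
  hamming-~ {x} {y} x~y@(i , xᵢ≢yᵢ , _) = trans
    (sum-single _ i λ j i≢j →
      trans (cong (λ b → diff b (lookup y j)) (~⇒agree {x} {y} x~y j i≢j)) (diff-refl (lookup y j)))
    (diff-≢ xᵢ≢yᵢ)

  -- By the triangle inequality, since each step has Hamming length 1. This is the lower bound for
  -- distances in the hypercube.
  hamming-walk : ∀ {k} {xs : Vec (Vec Bool n) (suc k)} → Linked _~_ xs →
                 hamming (head xs) (last xs) ≤ k
  hamming-walk {xs = x ∷ []} [-] = ≤-reflexive (hamming-refl x)
  hamming-walk {xs = x ∷ y ∷ xs} (x~y ∷ linked) = begin
    hamming x (last (x ∷ y ∷ xs))              ≡⟨ cong (hamming x) (last-∷ x (y ∷ xs)) ⟩
    hamming x (last (y ∷ xs))                  ≤⟨ hamming-triangle x y (last (y ∷ xs)) ⟩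
    hamming x y + hamming y (last (y ∷ xs))    ≤⟨ +-mono-≤ (≤-reflexive (hamming-~ {x} {y} x~y)) (hamming-walk linked) ⟩
    suc _                                      ∎
    where open ℕ.≤-Reasoning

  -- Since `x` and `y` agree off `i`, the distances from `w` to them differ only in their `i`-th
  -- terms, and these decide which is smaller.
  closer⇔agree : ∀ (x y : Vec Bool n) ((i , _) : x ~ y) (w : Vec Bool n) →
                 (hamming w x < hamming w y) ⇔ (lookup w i ≡ lookup x i)
  closer⇔agree x y x~y@(i , xᵢ≢yᵢ , _) w = mk⇔ to from
    where
    wᵢ = lookup w i
    xᵢ = lookup x i
    yᵢ = lookup y i

    shift : hamming w x + diff wᵢ yᵢ ≡ hamming w y + diff wᵢ xᵢ
    shift = sum-cong-except _ _ i λ j i≢j → cong (diff (lookup w j)) (~⇒agree {x} {y} x~y j i≢j)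

    from : wᵢ ≡ xᵢ → hamming w x < hamming w y
    from wᵢ≡xᵢ = ≤-reflexive $ begin
      suc (hamming w x)          ≡⟨ +-comm 1 _ ⟩
      hamming w x + 1            ≡⟨ cong (hamming w x +_) (diff-≢ (xᵢ≢yᵢ ∘ trans (sym wᵢ≡xᵢ))) ⟨
      hamming w x + diff wᵢ yᵢ   ≡⟨ shift ⟩
      hamming w y + diff wᵢ xᵢ   ≡⟨ cong (λ b → hamming w y + diff b xᵢ) wᵢ≡xᵢ ⟩
      hamming w y + diff xᵢ xᵢ   ≡⟨ cong (hamming w y +_) (diff-refl xᵢ) ⟩
      hamming w y + 0            ≡⟨ +-identityʳ _ ⟩
      hamming w y                ∎
      where open ≡-Reasoning

    to : hamming w x < hamming w y → wᵢ ≡ xᵢ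
    -- Otherwise `w` has the bit of `y` at `i`, there being only two bits, and is then no farther
    -- from `y` than from `x`.
    to wx<wy = decidable-stable (wᵢ Bool.≟ xᵢ) λ wᵢ≢xᵢ → ℕ.<⇒≱ wx<wy $ begin
      hamming w y                ≤⟨ ℕ.m≤m+n _ _ ⟩
      hamming w y + diff wᵢ xᵢ   ≡⟨ shift ⟨
      hamming w x + diff wᵢ yᵢ   ≡⟨ cong (λ b → hamming w x + diff b yᵢ) (≢-≢⇒≡ wᵢ≢xᵢ (xᵢ≢yᵢ ∘ sym)) ⟩
      hamming w x + diff yᵢ yᵢ   ≡⟨ cong (hamming w x +_) (diff-refl yᵢ) ⟩
      hamming w x + 0            ≡⟨ +-identityʳ _ ⟩
      hamming w x                ∎
      where open ℕ.≤-Reasoning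

-- The path built by `Q-connected` gains an edge exactly at the coordinates where its ends differ.
Q-connected-length : ∀ n (x y : Vec Bool n) → proj₁ (Q-connected n x y) ≡ hamming x y
Q-connected-length zero    []      []      = refl
Q-connected-length (suc n) (a ∷ x) (b ∷ y) with Q-connected n x y | Q-connected-length n x y
-- Concrete bits make the test `a Bool.≟ b` inside `Q-connected` compute.
Q-connected-length (suc n) (false ∷ _) (false ∷ _) | _ , _ , isPath refl refl _ _ | eq = eq
Q-connected-length (suc n) (false ∷ _) (true ∷ _)  | _ , _ , isPath refl refl _ _ | eq = cong suc eq
Q-connected-length (suc n) (true ∷ _)  (false ∷ _) | _ , _ , isPath refl refl _ _ | eq = cong suc eq
Q-connected-length (suc n) (true ∷ _)  (true ∷ _)  | _ , _ , isPath refl refl _ _ | eq = eq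

-- Minimality against the path of `Q-connected` bounds `k` above; `hamming-walk` bounds it below.
Q-distance : ∀ {n} {x y : Vec Bool n} {k} → IsDistance (Q n) x y k → k ≡ hamming x y
Q-distance {n} {x} {y} ((xs , isPath refl refl linked _) , minimal) = ≤-antisym
  (subst (_ ≤_) (Q-connected-length n x y) (minimal _ (proj₂ (Q-connected n x y))))
  (hamming-walk linked)

-- Oriented hypercube edges by direction

-- The covering relation of the order on strings, in direction `i`. Each edge is oriented towards
-- its end with bit 1, so it is counted once; the update form matches closure under switching bits
-- off.
_⋖[_]_ : ∀ {n} → Vec Bool n → Fin n → Vec Bool n → Set
x ⋖[ i ] y = lookup y i ≡ true × x ≡ y [ i ]≔ false

_⋖[_]?_ : ∀ {n} (x : Vec Bool n) i y → Dec (x ⋖[ i ] y)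
x ⋖[ i ]? y = (lookup y i Bool.≟ true) ×-dec Vec.≡-dec Bool._≟_ x (y [ i ]≔ false)

module _ {n : ℕ} where
  open Graph (Q n)

  ⋖⇒lookup≡false : ∀ {x y : Vec Bool n} {i} → x ⋖[ i ] y → lookup x i ≡ false
  ⋖⇒lookup≡false {y = y} {i} (_ , refl) = Vec.lookup∘update i y false

  ⋖-irrefl : ∀ {x : Vec Bool n} {i} → ¬ x ⋖[ i ] x
  ⋖-irrefl x⋖x with () ← trans (sym (proj₁ x⋖x)) (⋖⇒lookup≡false x⋖x)

  ⋖-asym : ∀ {x y : Vec Bool n} {i} → x ⋖[ i ] y → ¬ y ⋖[ i ] x
  ⋖-asym x⋖y y⋖x with () ← trans (sym (proj₁ y⋖x)) (⋖⇒lookup≡false x⋖y)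

  -- The lower end determines the upper one, which gives uniqueness of upper neighbours.
  ⋖⇒≡-update : ∀ {x y : Vec Bool n} {i} → x ⋖[ i ] y → y ≡ x [ i ]≔ true
  ⋖⇒≡-update {y = y} {i} (yᵢ≡true , refl) = begin
    y                              ≡⟨ Vec.[]≔-lookup y i ⟨
    y [ i ]≔ lookup y i            ≡⟨ cong (y [ i ]≔_) yᵢ≡true ⟩
    y [ i ]≔ true                  ≡⟨ Vec.[]≔-idempotent y i ⟨
    y [ i ]≔ false [ i ]≔ true     ∎
    where open ≡-Reasoning

  ⋖⇒differs : ∀ {x y : Vec Bool n} {i} → x ⋖[ i ] y → DiffersAt x y i
  ⋖⇒differs x⋖y xᵢ≡yᵢ
    with () ← trans (sym (⋖⇒lookup≡false x⋖y)) (trans xᵢ≡yᵢ (proj₁ x⋖y))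

  ⋖⇒~ : ∀ {x y : Vec Bool n} {i} → x ⋖[ i ] y → x ~ y
  ⋖⇒~ {x} {y} {i} x⋖y@(_ , refl) = i , ⋖⇒differs x⋖y , λ {j} → unique j
    where
    unique : ∀ j → DiffersAt x y j → i ≡ j
    unique j xⱼ≢yⱼ = decidable-stable (i Fin.≟ j) λ i≢j →
      xⱼ≢yⱼ (Vec.lookup∘update′ (i≢j ∘ sym) y false)

  ~⇒⋖ : ∀ {x y : Vec Bool n} ((i , _) : x ~ y) → lookup y i ≡ true → x ⋖[ i ] y
  ~⇒⋖ {x} {y} x~y@(i , xᵢ≢yᵢ , _) yᵢ≡true = yᵢ≡true , Pointwise-≡⇒≡ (ext agree)
    where
    agree : ∀ j → lookup x j ≡ lookup (y [ i ]≔ false) j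
    agree j with i Fin.≟ j
    ... | yes refl = trans (Bool.¬-not (xᵢ≢yᵢ ∘ λ e → trans e (sym yᵢ≡true)))
                           (sym (Vec.lookup∘update i y false))
    ... | no i≢j   = trans (~⇒agree {n} {x} {y} x~y j i≢j)
                           (sym (Vec.lookup∘update′ (i≢j ∘ sym) y false))

  -- An adjacent pair is a cover in exactly one direction and one orientation, so one term survives
  -- on the right; for a non-adjacent pair none does. This distributes an edge weight over the
  -- directions.
  𝟙-adjacent : ∀ (x y : Vec Bool n) {A : Set} (a? : Dec A) → A ⇔ x ~ y →
               (m : ℕ) (c : Fin n → ℕ) → (∀ ((i , _) : x ~ y) → m ≡ c i) →
               𝟙 a? * m ≡ ∑[ i < n ] ((𝟙 (x ⋖[ i ]? y) + 𝟙 (y ⋖[ i ]? x)) * c i)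
  𝟙-adjacent x y (no ¬a) A⇔~ m c m≡c = sym $ sum-zero λ i →
    cong (_* c i) (cong₂ _+_ (𝟙-false (x ⋖[ i ]? y) (x≁y ∘ ⋖⇒~))
                             (𝟙-false (y ⋖[ i ]? x) (x≁y ∘ ~-sym {y} {x} ∘ ⋖⇒~)))
    where
    x≁y : ¬ x ~ y
    x≁y = ¬a ∘ Equivalence.from A⇔~
  𝟙-adjacent x y (yes a) A⇔~ m c m≡c = sym $ begin
    ∑[ j < n ] ((𝟙 (x ⋖[ j ]? y) + 𝟙 (y ⋖[ j ]? x)) * c j)
      -- A cover in direction `j` differs at `j`, while the ends of the edge differ only at `i`.
      ≡⟨ sum-single _ i (λ j i≢j → cong (_* c j) (cong₂ _+_
           (𝟙-false (x ⋖[ j ]? y) (i≢j ∘ same x~y))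
           (𝟙-false (y ⋖[ j ]? x) (i≢j ∘ same (~-sym {x} {y} x~y))))) ⟩
    (𝟙 (x ⋖[ i ]? y) + 𝟙 (y ⋖[ i ]? x)) * c i
      ≡⟨ cong₂ _*_ (oriented (lookup y i) refl) (sym (m≡c x~y)) ⟩
    1 * m
      ∎
    where
    open ≡-Reasoning
    x~y = Equivalence.to A⇔~ a
    i = proj₁ x~y
    xᵢ≢yᵢ = proj₁ (proj₂ x~y)

    same : ∀ {u v j} (u~v : u ~ v) → u ⋖[ j ] v → proj₁ u~v ≡ j
    same (_ , _ , unique) u⋖v = unique (⋖⇒differs u⋖v)

    oriented : ∀ b → lookup y i ≡ b → 𝟙 (x ⋖[ i ]? y) + 𝟙 (y ⋖[ i ]? x) ≡ 1
    oriented true yᵢ≡true = cong₂ _+_ (𝟙-true (x ⋖[ i ]? y) x⋖y)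
                                      (𝟙-false (y ⋖[ i ]? x) (⋖-asym x⋖y))
      where x⋖y = ~⇒⋖ x~y yᵢ≡true
    oriented false yᵢ≡false = cong₂ _+_ (𝟙-false (x ⋖[ i ]? y) (⋖-asym y⋖x))
                                        (𝟙-true (y ⋖[ i ]? x) y⋖x)
      where y⋖x = ~⇒⋖ (~-sym {x} {y} x~y) (Bool.¬-not (xᵢ≢yᵢ ∘ λ e → trans e (sym yᵢ≡false)))

-- Counting in a family of strings closed under switching bits off

module Family {N n : ℕ} (p : Fin N → Vec Bool n) (p-injective : Injective _≡_ _≡_ p)
              (p-lower : ∀ k i → ∃ λ j → p j ≡ p k [ i ]≔ false) where

  count : Fin n → Bool → ℕ
  count i b = ∑[ k < N ] 𝟙 (lookup (p k) i Bool.≟ b)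

  count-total : ∀ i → count i true + count i false ≡ N
  count-total i = begin
    count i true + count i false   ≡⟨ ∑-distrib-+ (λ k → 𝟙 (lookup (p k) i Bool.≟ true)) _ ⟨
    ∑[ k < N ] (𝟙 (lookup (p k) i Bool.≟ true) + 𝟙 (lookup (p k) i Bool.≟ false))
                                   ≡⟨ sum-cong-≗ (λ k → one (lookup (p k) i)) ⟩
    ∑[ k < N ] 1                   ≡⟨ sum-const-1 N ⟩
    N                              ∎
    where
    open ≡-Reasoning
    one : ∀ b → 𝟙 (b Bool.≟ true) + 𝟙 (b Bool.≟ false) ≡ 1
    one false = refl
    one true  = refl

  -- Switching off bit `i` stays in the family by `p-lower`, and injectivity of `p` makes the
  -- resulting index unique.
  lower-neighbours : ∀ i k → ∑[ j < N ] 𝟙 (p j ⋖[ i ]? p k) ≡ 𝟙 (lookup (p k) i Bool.≟ true)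
  lower-neighbours i k with p-lower k i
  ... | j , pⱼ≡ = trans
    (sum-single _ j λ l j≢l → 𝟙-false (p l ⋖[ i ]? p k)
      λ (_ , pₗ≡) → j≢l (p-injective (trans pⱼ≡ (sym pₗ≡))))
    -- For this `j` the update equation already holds, so only the condition on the bit is left.
    (𝟙-cong (p j ⋖[ i ]? p k) _ (mk⇔ proj₁ (_, pⱼ≡)))

  -- Only an inequality, because switching a bit on may leave the family.
  upper-neighbours : ∀ i j → ∑[ k < N ] 𝟙 (p j ⋖[ i ]? p k) ≤ 𝟙 (lookup (p j) i Bool.≟ false)
  upper-neighbours i j with lookup (p j) i Bool.≟ false
  ... | yes _ = sum-𝟙≤1 (λ k → p j ⋖[ i ]? p k)
    λ c c′ → p-injective (trans (⋖⇒≡-update c) (sym (⋖⇒≡-update c′)))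
  ... | no pⱼᵢ≢false = ≤-reflexive $ sum-zero λ k →
    𝟙-false (p j ⋖[ i ]? p k) (pⱼᵢ≢false ∘ ⋖⇒lookup≡false)

  -- Counts the edges in direction `i` by their upper ends.
  ∑⋖ : ∀ i → ∑[ j < N ] ∑[ k < N ] 𝟙 (p j ⋖[ i ]? p k) ≡ count i true
  ∑⋖ i = trans (∑-comm λ j k → 𝟙 (p j ⋖[ i ]? p k)) (sum-cong-≗ (lower-neighbours i))

  -- Counts the same edges by their lower ends.
  count-true≤count-false : ∀ i → count i true ≤ count i false
  count-true≤count-false i =
    subst (_≤ count i false) (∑⋖ i) (sum-mono-≤ (upper-neighbours i))

  -- With `a ≤ b` the absolute difference is `b ∸ a`, and it turns the `a` in `N = a + b` into a
  -- second `b`.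
  total+imbalance : ∀ i → N + ∣ count i true - count i false ∣ ≡ 2 * count i false
  total+imbalance i = begin
    N + ∣ a - b ∣              ≡⟨ cong₂ _+_ (sym (count-total i)) (ℕ.m≤n⇒∣m-n∣≡n∸m a≤b) ⟩
    a + b + (b ∸ a)          ≡⟨ cong (_+ (b ∸ a)) (+-comm a b) ⟩
    b + a + (b ∸ a)          ≡⟨ ℕ.+-assoc b a _ ⟩
    b + (a + (b ∸ a))        ≡⟨ cong (b +_) (ℕ.m+[n∸m]≡n a≤b) ⟩
    b + b                      ≡⟨ cong (_+_ b) (+-identityʳ b) ⟨
    2 * b                      ∎
    where
    open ≡-Reasoning
    a = count i true
    b = count i false
    a≤b = count-true≤count-false i

  -- Holds direction by direction: it is `total+imbalance` multiplied by `count i true`. For a daisy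
  -- cube the three sums will be the Mostar index, the size and the Wiener index.
  ∑-imbalance : ∑[ i < n ] (count i true * ∣ count i true - count i false ∣)
                  + N * ∑[ i < n ] count i true
                ≡ 2 * ∑[ i < n ] (count i false * count i true)
  ∑-imbalance = begin
    ∑[ i < n ] (count i true * gap i) + N * ∑[ i < n ] count i true
      ≡⟨ cong (∑[ i < n ] (count i true * gap i) +_) (*-distribˡ-sum N (λ i → count i true)) ⟩
    ∑[ i < n ] (count i true * gap i) + ∑[ i < n ] (N * count i true)
      ≡⟨ ∑-distrib-+ (λ i → count i true * gap i) (λ i → N * count i true) ⟨
    ∑[ i < n ] (count i true * gap i + N * count i true)
      ≡⟨ sum-cong-≗ (λ i → trans (factor (count i true) (gap i) N)
                        (trans (cong (_* count i true) (total+imbalance i))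
                               (ℕ.*-assoc 2 (count i false) (count i true)))) ⟩
    ∑[ i < n ] (2 * (count i false * count i true))
      ≡⟨ *-distribˡ-sum 2 (λ i → count i false * count i true) ⟨
    2 * ∑[ i < n ] (count i false * count i true)
      ∎
    where
    open ≡-Reasoning
    gap : Fin n → ℕ
    gap i = ∣ count i true - count i false ∣

    factor : ∀ a g m → a * g + m * a ≡ (m + g) * a
    factor = solve-∀

-- The indices of a daisy cube in terms of bit counts

module _ (G : FiniteGraph) (daisy : IsDaisyCube (FiniteGraph.graph G)) where
  open FiniteGraph G
  open IsometricEmbedding (proj₁ (proj₂ daisy)) using (to; injective; adjacent; isometric)
  private
    n = proj₁ daisy
    image≐ = proj₂ (proj₂ (proj₂ daisy))
    conn = daisyCube⇒connected daisy
    module Qₙ = Graph (Q n)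

  vertex : Fin order → Vertex
  vertex = Inverse.to enum

  code : Fin order → Vec Bool n
  code = to ∘ vertex

  code-injective : Injective _≡_ _≡_ code
  code-injective = Injection.injective (↔⇒↣ enum) ∘ injective

  -- A vertex lies below some generator `x`. Switching off a bit keeps it below `x`, hence in the
  -- image of the embedding.
  code-lower : ∀ k i → ∃ λ j → code j ≡ code k [ i ]≔ false
  code-lower k i =
    let x , Xx , code≤x = proj₁ (proj₁ image≐) (vertex k , refl)
        u , u≡ = proj₂ (proj₁ image≐) (x , Xx , Pointwise.trans Bool.≤-trans lower≤ code≤x)
    in Inverse.from enum u , trans (cong to (Inverse.strictlyInverseˡ enum u)) u≡
    where
    at : ∀ j → lookup (code k [ i ]≔ false) j Bool.≤ lookup (code k) j
    at j with i Fin.≟ j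
    ... | yes refl rewrite Vec.lookup∘update i (code k) false = Bool.≤-minimum _
    ... | no i≢j = Bool.≤-reflexive (Vec.lookup∘update′ (i≢j ∘ sym) (code k) false)
    lower≤ = extensional⇒inductive (ext at)

  -- The image is an induced subgraph, so an edge between images comes from an edge of `G`, whose
  -- ends injectivity identifies.
  adjacent⇔ : ∀ {u v} → u ~ v ⇔ to u Qₙ.~ to v
  adjacent⇔ {u} {v} = mk⇔ adjacent reflect
    where
    reflect : to u Qₙ.~ to v → u ~ v
    reflect tu~tv with proj₂ (proj₂ image≐)
      (proj₁ (proj₁ image≐) (u , refl) , proj₁ (proj₁ image≐) (v , refl) , tu~tv)
    ... | _ , _ , u′~v′ , tu′≡tu , tv′≡tv = subst₂ _~_ (injective tu′≡tu) (injective tv′≡tv) u′~v′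

  d≡hamming : ∀ u v → d G conn u v ≡ hamming (to u) (to v)
  d≡hamming u v = Q-distance (Equivalence.to (isometric u v _) (d-isDistance G conn u v))

  open Family code code-injective code-lower

  -- Direction `i` adds 1 to the distance of exactly those pairs with one vertex of bit 0 and one of
  -- bit 1.
  wiener≡ : wiener G conn ≡ ∑[ i < n ] (count i false * count i true)
  wiener≡ = begin
    wiener G conn
      ≡⟨ sum-unorderedPairs (uncurry (d G conn)) vertex (λ j k → ∑[ i < n ] up i j k)
           (λ j k → trans (d≡hamming (vertex j) (vertex k)) (∑-distrib-+ (λ i → up i j k) (λ i → up i k j)))
           (λ j → sum-zero λ i → rise-refl (lookup (code j) i)) ⟩
    ∑[ j < order ] ∑[ k < order ] ∑[ i < n ] up i j k
      ≡⟨ ∑-rotate up ⟩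
    ∑[ i < n ] ∑[ j < order ] ∑[ k < order ] up i j k
      ≡⟨ sum-cong-≗ (λ i → ∑-distrib-*₂ (λ j → 𝟙 (lookup (code j) i Bool.≟ false))
                                        (λ k → 𝟙 (lookup (code k) i Bool.≟ true))) ⟩
    ∑[ i < n ] (count i false * count i true)
      ∎
    where
    open ≡-Reasoning
    up : Fin n → Fin order → Fin order → ℕ
    up i j k = rise (lookup (code j) i) (lookup (code k) i)

  -- For a weight depending only on the direction of an edge, it remains to count edges per
  -- direction, which `∑⋖` does. Constant weight 1 gives the size, the imbalance gives the Mostar
  -- index.
  sum-edges : (m : Vertex × Vertex → ℕ) (c : Fin n → ℕ) →
              (∀ u v ((i , _) : to u Qₙ.~ to v) → m (u , v) ≡ c i) →
              Listᴺ.sum (List.map m (edges G)) ≡ ∑[ i < n ] (count i true * c i)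
  sum-edges m c m≡c = begin
    Listᴺ.sum (List.map m (edges G))
      ≡⟨ sum-map-filter (λ (u , v) → u ~? v) m (unorderedPairs (vertices G)) ⟩
    Listᴺ.sum (List.map (λ (u , v) → 𝟙 (u ~? v) * m (u , v)) (unorderedPairs (vertices G)))
      ≡⟨ sum-unorderedPairs (λ (u , v) → 𝟙 (u ~? v) * m (u , v)) vertex
           (λ j k → ∑[ i < n ] (cover i j k * c i)) split
           (λ j → sum-zero λ i → cong (_* c i) (𝟙-false (code j ⋖[ i ]? code j) ⋖-irrefl)) ⟩
    ∑[ j < order ] ∑[ k < order ] ∑[ i < n ] (cover i j k * c i)
      ≡⟨ ∑-rotate (λ i j k → cover i j k * c i) ⟩
    ∑[ i < n ] ∑[ j < order ] ∑[ k < order ] (cover i j k * c i)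
      ≡⟨ sum-cong-≗ (λ i → trans (∑∑-*-distribʳ (cover i) (c i)) (cong (_* c i) (∑⋖ i))) ⟩
    ∑[ i < n ] (count i true * c i)
      ∎
    where
    open ≡-Reasoning
    cover : Fin n → Fin order → Fin order → ℕ
    cover i j k = 𝟙 (code j ⋖[ i ]? code k)

    split : ∀ j k → 𝟙 (vertex j ~? vertex k) * m (vertex j , vertex k) ≡
            ∑[ i < n ] (cover i j k * c i) + ∑[ i < n ] (cover i k j * c i)
    split j k = begin
      𝟙 (vertex j ~? vertex k) * m (vertex j , vertex k)
        ≡⟨ 𝟙-adjacent (code j) (code k) (vertex j ~? vertex k) adjacent⇔
           (m (vertex j , vertex k)) c (m≡c (vertex j) (vertex k)) ⟩
      ∑[ i < n ] ((cover i j k + cover i k j) * c i)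
        ≡⟨ sum-cong-≗ (λ i → ℕ.*-distribʳ-+ (c i) (cover i j k) (cover i k j)) ⟩
      ∑[ i < n ] (cover i j k * c i + cover i k j * c i)
        ≡⟨ ∑-distrib-+ (λ i → cover i j k * c i) (λ i → cover i k j * c i) ⟩
      ∑[ i < n ] (cover i j k * c i) + ∑[ i < n ] (cover i k j * c i)
        ∎

  size≡ : size G ≡ ∑[ i < n ] count i true
  size≡ = begin
    size G                                        ≡⟨ length≡sum (edges G) ⟩
    Listᴺ.sum (List.map (λ _ → 1) (edges G))      ≡⟨ sum-edges (λ _ → 1) (λ _ → 1) (λ _ _ _ → refl) ⟩
    ∑[ i < n ] (count i true * 1)                 ≡⟨ sum-cong-≗ (λ i → ℕ.*-identityʳ (count i true)) ⟩
    ∑[ i < n ] count i true                       ∎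
    where open ≡-Reasoning

  closer≡count : ∀ u v ((i , _) : to u Qₙ.~ to v) →
                 closer G conn u v ≡ count i (lookup (to u) i)
  closer≡count u v u~v@(i , _) = trans
    (length-filter-tabulate (λ w → d G conn w u ℕ.<? d G conn w v) vertex)
    (sum-cong-≗ λ k → 𝟙-cong (d G conn (vertex k) u ℕ.<? d G conn (vertex k) v)
                             (lookup (code k) i Bool.≟ lookup (to u) i)
      (subst₂ (λ a b → (a < b) ⇔ (lookup (code k) i ≡ lookup (to u) i))
        (sym (d≡hamming (vertex k) u)) (sym (d≡hamming (vertex k) v))
        (closer⇔agree (to u) (to v) u~v (code k))))

  mostar≡ : mostar G conn ≡ ∑[ i < n ] (count i true * ∣ count i true - count i false ∣)
  mostar≡ = sum-edges (λ (u , v) → ∣ closer G conn u v - closer G conn v u ∣)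
                      (λ i → ∣ count i true - count i false ∣) λ u v u~v@(i , uᵢ≢vᵢ , _) → trans
    (cong₂ ∣_-_∣ (closer≡count u v u~v) (closer≡count v u (Qₙ.~-sym {to u} {to v} u~v)))
    (unordered i (lookup (to u) i) (lookup (to v) i) uᵢ≢vᵢ)
    where
    -- Either end of the edge may carry the bit 1; the absolute difference is the same both ways.
    unordered : ∀ i a b → a ≢ b → ∣ count i a - count i b ∣ ≡ ∣ count i true - count i false ∣
    unordered i true  false _   = refl
    unordered i false true  _   = ℕ.∣-∣-comm (count i false) (count i true)
    unordered i true  true  a≢a = contradiction refl a≢a
    unordered i false false a≢a = contradiction refl a≢a

  -- The additive form of the theorem, which stays within `ℕ`.
  mostar+order*size≡2*wiener : mostar G conn + order * size G ≡ 2 * wiener G conn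
  mostar+order*size≡2*wiener = begin
    mostar G conn + order * size G
      ≡⟨ cong₂ (λ a b → a + order * b) mostar≡ size≡ ⟩
    ∑[ i < n ] (count i true * ∣ count i true - count i false ∣) + order * ∑[ i < n ] count i true
      ≡⟨ ∑-imbalance ⟩
    2 * ∑[ i < n ] (count i false * count i true)
      ≡⟨ cong (2 *_) wiener≡ ⟨
    2 * wiener G conn
      ∎
    where open ≡-Reasoning

-- The identity with integer subtraction

open import Data.Integer.Base using (+_; _-_; _⊖_)

theorem3p1 : (G : FiniteGraph) (daisy : IsDaisyCube (FiniteGraph.graph G)) →
    let conn = daisyCube⇒connected daisy in
    (+ (2 * wiener G conn)) - (+ mostar G conn) ≡ + (FiniteGraph.order G * size G)
theorem3p1 G daisy = begin
  + (2 * W) - + Mo              ≡⟨ cong (λ k → + k - + Mo) (mostar+order*size≡2*wiener G daisy) ⟨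
  + (Mo + NE) - + Mo            ≡⟨ ℤ.[+m]-[+n]≡m⊖n (Mo + NE) Mo ⟩
  (Mo + NE) ⊖ Mo                ≡⟨ ℤ.⊖-≥ (ℕ.m≤m+n Mo NE) ⟩
  + (Mo + NE ∸ Mo)            ≡⟨ cong +_ (ℕ.m+n∸m≡n Mo NE) ⟩
  + NE                          ∎
  where
  open ≡-Reasoning
  conn = daisyCube⇒connected daisy
  W    = wiener G conn
  Mo   = mostar G conn
  NE   = FiniteGraph.order G * size G
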